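{- Let $Sp$ be an unbalanced split graph. Then $\operatorname{Supp}(Sp)$ is contained in the intersection of all the maximum independent sets of $Sp$.
   Context: Graphs are finite and simple. A split graph is a graph $Sp$ with at least one vertex whose vertex set is a disjoint union of a clique $K$ and an independent set $S$; such a pair $(K,S)$ is called an s-partition for $Sp$ (here one of the two parts may be empty). $\omega(Sp)$ and $\alpha(Sp)$ are the clique number and independence number. A split graph with s-partition $(K,S)$ is balanced if $|K|=\omega(Sp)$ and $|S|=\alpha(Sp)$, and unbalanced otherwise (this does not depend on the s-partition chosen). A maximum independent set is an independent set of size $\alpha(Sp)$. $\operatorname{Supp}(Sp)$ is the set of vertices $v$ such that $x_v\ne 0$ for some real vector $x$ in the nullspace of the adjacency matrix of $Sp$. -}

module Defs where

import Algebra.Properties.CommutativeSemigroup as CommutativeSemigroupProperties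
open import Algebra.Bundles using (CommutativeMonoid)
open import Data.Bool.Base using (if_then_else_)
open import Data.Fin.Base using (Fin)
open import Data.Fin.Properties using (_≟_; all?)
open import Data.Fin.Subset using (Subset; inside; outside; _∈_; _∪_; _∩_; ⊤; Empty; ∣_∣)
open import Data.Fin.Subset.Properties using (_∈?_)
open import Data.List.Base using (List; []; _∷_; _++_; map; filter)
open import Data.List.Extrema.Nat using (max)
open import Data.Nat.Base as ℕ using (ℕ; zero; suc; _⊔_)
import Data.Nat.Properties as ℕ
open import Data.Product.Base using (∃₂; ∃-syntax; _×_; _,_)
open import Data.Rational.Base as ℚ using (ℚ; 0ℚ; 1ℚ)
import Data.Rational.Properties as ℚ
open import Data.Vec.Base using ([]; _∷_)
open import Data.Vec.Functional using (Vector; foldr)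
open import Level using (0ℓ)
open import Relation.Binary.Core using (Rel)
open import Relation.Binary.Definitions using (Decidable; Symmetric; Irreflexive)
open import Relation.Binary.PropositionalEquality using (_≡_; _≢_; sym; trans; cong; cong₂; subst; module ≡-Reasoning)
open import Relation.Nullary.Decidable using (Dec; does; _→-dec_; ¬?)
open import Relation.Nullary.Negation using (¬_)
open import Relation.Unary using (Pred)

------------------------------------------------------------------------
-- Real numbers, as Cauchy sequences of rationals up to the equivalence _≈_

IsCauchy : (ℕ → ℚ) → Set
IsCauchy s = ∀ ε → 0ℚ ℚ.< ε →
  ∃[ N ] (∀ m n → N ℕ.≤ m → N ℕ.≤ n → ℚ.∣ s m ℚ.- s n ∣ ℚ.< ε)

record ℝ : Set where
  constructor mkℝ
  field
    seq    : ℕ → ℚ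
    cauchy : IsCauchy seq

open ℝ public

infix 4 _≈_

-- The difference of the two sequences tends to 0.
_≈_ : Rel ℝ 0ℓ
x ≈ y = ∀ ε → 0ℚ ℚ.< ε →
  ∃[ N ] (∀ n → N ℕ.≤ n → ℚ.∣ seq x n ℚ.- seq y n ∣ ℚ.< ε)

private

  cancel : ∀ p q → (p ℚ.- q) ℚ.+ q ≡ p
  cancel p q = begin
    (p ℚ.- q) ℚ.+ q         ≡⟨ ℚ.+-assoc p (ℚ.- q) q ⟩
    p ℚ.+ (ℚ.- q ℚ.+ q)     ≡⟨ cong (p ℚ.+_) (ℚ.+-inverseˡ q) ⟩
    p ℚ.+ 0ℚ                ≡⟨ ℚ.+-identityʳ p ⟩
    p                       ∎
    where open ≡-Reasoning

  +-swap-- : ∀ a b c d → (a ℚ.+ b) ℚ.- (c ℚ.+ d) ≡ (a ℚ.- c) ℚ.+ (b ℚ.- d)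
  +-swap-- a b c d = trans
    (cong ((a ℚ.+ b) ℚ.+_) (ℚ.neg-distrib-+ c d))
    (interchange a b (ℚ.- c) (ℚ.- d))
    where
    open CommutativeSemigroupProperties
      (CommutativeMonoid.commutativeSemigroup ℚ.+-0-commutativeMonoid)

  product-difference : ∀ a b c d →
    (a ℚ.* b) ℚ.- (c ℚ.* d) ≡ a ℚ.* (b ℚ.- d) ℚ.+ d ℚ.* (a ℚ.- c)
  product-difference a b c d = sym (begin
    a ℚ.* (b ℚ.- d) ℚ.+ d ℚ.* (a ℚ.- c)
      ≡⟨ cong₂ ℚ._+_ (distrib a b d) (distrib d a c) ⟩
    (a ℚ.* b ℚ.- a ℚ.* d) ℚ.+ (d ℚ.* a ℚ.- d ℚ.* c)
      ≡⟨ cong₂ (λ p q → (a ℚ.* b ℚ.- a ℚ.* d) ℚ.+ (p ℚ.- q)) (ℚ.*-comm d a) (ℚ.*-comm d c) ⟩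
    (a ℚ.* b ℚ.- a ℚ.* d) ℚ.+ (a ℚ.* d ℚ.- c ℚ.* d)
      ≡⟨ sym (ℚ.+-assoc (a ℚ.* b ℚ.- a ℚ.* d) (a ℚ.* d) (ℚ.- (c ℚ.* d))) ⟩
    ((a ℚ.* b ℚ.- a ℚ.* d) ℚ.+ a ℚ.* d) ℚ.- c ℚ.* d
      ≡⟨ cong (ℚ._- c ℚ.* d) (cancel (a ℚ.* b) (a ℚ.* d)) ⟩
    a ℚ.* b ℚ.- c ℚ.* d
      ∎)
    where
    open ≡-Reasoning
    distrib : ∀ p q r → p ℚ.* (q ℚ.- r) ≡ p ℚ.* q ℚ.- p ℚ.* r
    distrib p q r = trans (ℚ.*-distribˡ-+ p q (ℚ.- r))
      (cong (p ℚ.* q ℚ.+_) (sym (ℚ.neg-distribʳ-* p r)))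

  double : ∀ p → p ℚ.+ p ≡ (1ℚ ℚ.+ 1ℚ) ℚ.* p
  double p = sym (trans (ℚ.*-distribʳ-+ p 1ℚ 1ℚ)
    (cong₂ ℚ._+_ (ℚ.*-identityˡ p) (ℚ.*-identityˡ p)))

  -- Any positive c splits ε as c * δ with δ positive.
  scale : ∀ c ε → 0ℚ ℚ.< c → 0ℚ ℚ.< ε → ∃[ δ ] (0ℚ ℚ.< δ × c ℚ.* δ ≡ ε)
  scale c ε 0<c 0<ε = 1/c ℚ.* ε , ℚ.positive⁻¹ _ {{pos}} , eq
    where
    instance
      c-pos : ℚ.Positive c
      c-pos = ℚ.positive 0<c
      c-nz : ℚ.NonZero c
      c-nz = ℚ.pos⇒nonZero c
      ε-pos : ℚ.Positive ε
      ε-pos = ℚ.positive 0<ε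
    1/c : ℚ
    1/c = ℚ.1/ c
    pos : ℚ.Positive (1/c ℚ.* ε)
    pos = ℚ.pos*pos⇒pos 1/c {{ℚ.1/pos⇒pos c}} ε
    eq : c ℚ.* (1/c ℚ.* ε) ≡ ε
    eq = trans (sym (ℚ.*-assoc c 1/c ε))
        (trans (cong (ℚ._* ε) (ℚ.*-inverseʳ c)) (ℚ.*-identityˡ ε))

  0<1 : 0ℚ ℚ.< 1ℚ
  0<1 = ℚ.positive⁻¹ 1ℚ

  bounded : ∀ x → ∃[ B ] (0ℚ ℚ.< B × ∃[ N ] (∀ n → N ℕ.≤ n → ℚ.∣ seq x n ∣ ℚ.≤ B))
  bounded x with cauchy x 1ℚ 0<1
  ... | N , close = 1ℚ ℚ.+ ℚ.∣ a ∣ , 0<B , N , bound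
    where
    a : ℚ
    a = seq x N
    0<B : 0ℚ ℚ.< 1ℚ ℚ.+ ℚ.∣ a ∣
    0<B = ℚ.+-mono-<-≤ 0<1 (ℚ.0≤∣p∣ a)
    bound : ∀ n → N ℕ.≤ n → ℚ.∣ seq x n ∣ ℚ.≤ 1ℚ ℚ.+ ℚ.∣ a ∣
    bound n N≤n = begin
      ℚ.∣ seq x n ∣                       ≡⟨ cong ℚ.∣_∣ (sym (cancel (seq x n) a)) ⟩
      ℚ.∣ (seq x n ℚ.- a) ℚ.+ a ∣         ≤⟨ ℚ.∣p+q∣≤∣p∣+∣q∣ (seq x n ℚ.- a) a ⟩
      ℚ.∣ seq x n ℚ.- a ∣ ℚ.+ ℚ.∣ a ∣     ≤⟨ ℚ.+-monoˡ-≤ ℚ.∣ a ∣ (ℚ.<⇒≤ (close n N N≤n ℕ.≤-refl)) ⟩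
      1ℚ ℚ.+ ℚ.∣ a ∣                      ∎
      where open ℚ.≤-Reasoning

  const-cauchy : ∀ q → IsCauchy (λ _ → q)
  const-cauchy q ε 0<ε = 0 , λ _ _ _ _ →
    subst (ℚ._< ε) (sym (cong ℚ.∣_∣ (ℚ.+-inverseʳ q))) 0<ε

  +-cauchy : ∀ x y → IsCauchy (λ n → seq x n ℚ.+ seq y n)
  +-cauchy x y ε 0<ε with scale (1ℚ ℚ.+ 1ℚ) ε (ℚ.positive⁻¹ _) 0<ε
  ... | δ , 0<δ , 2δ≡ε with cauchy x δ 0<δ | cauchy y δ 0<δ
  ... | N , closeˣ | M , closeʸ = N ⊔ M , close
    where
    close : ∀ m n → N ⊔ M ℕ.≤ m → N ⊔ M ℕ.≤ n →
            ℚ.∣ (seq x m ℚ.+ seq y m) ℚ.- (seq x n ℚ.+ seq y n) ∣ ℚ.< ε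
    close m n ≤m ≤n = begin-strict
      ℚ.∣ (a ℚ.+ b) ℚ.- (c ℚ.+ d) ∣             ≡⟨ cong ℚ.∣_∣ (+-swap-- a b c d) ⟩
      ℚ.∣ (a ℚ.- c) ℚ.+ (b ℚ.- d) ∣             ≤⟨ ℚ.∣p+q∣≤∣p∣+∣q∣ (a ℚ.- c) (b ℚ.- d) ⟩
      ℚ.∣ a ℚ.- c ∣ ℚ.+ ℚ.∣ b ℚ.- d ∣           <⟨ ℚ.+-mono-<
                                                     (closeˣ m n (ℕ.m⊔n≤o⇒m≤o N M ≤m) (ℕ.m⊔n≤o⇒m≤o N M ≤n))
                                                     (closeʸ m n (ℕ.m⊔n≤o⇒n≤o N M ≤m) (ℕ.m⊔n≤o⇒n≤o N M ≤n)) ⟩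
      δ ℚ.+ δ                                   ≡⟨ double δ ⟩
      (1ℚ ℚ.+ 1ℚ) ℚ.* δ                         ≡⟨ 2δ≡ε ⟩
      ε                                         ∎
      where
      open ℚ.≤-Reasoning
      a b c d : ℚ
      a = seq x m
      b = seq y m
      c = seq x n
      d = seq y n

  *-cauchy : ∀ x y → IsCauchy (λ n → seq x n ℚ.* seq y n)
  *-cauchy x y ε 0<ε with bounded x | bounded y
  ... | B , 0<B , N₁ , boundˣ | C , 0<C , N₂ , boundʸ
    with scale (B ℚ.+ C) ε (ℚ.+-mono-< 0<B 0<C) 0<ε
  ... | δ , 0<δ , [B+C]δ≡ε with cauchy x δ 0<δ | cauchy y δ 0<δ
  ... | N₃ , closeˣ | N₄ , closeʸ = (N₁ ⊔ N₂) ⊔ (N₃ ⊔ N₄) , close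
    where
    close : ∀ m n → (N₁ ⊔ N₂) ⊔ (N₃ ⊔ N₄) ℕ.≤ m → (N₁ ⊔ N₂) ⊔ (N₃ ⊔ N₄) ℕ.≤ n →
            ℚ.∣ (seq x m ℚ.* seq y m) ℚ.- (seq x n ℚ.* seq y n) ∣ ℚ.< ε
    close m n ≤m ≤n = begin-strict
      ℚ.∣ (a ℚ.* b) ℚ.- (c ℚ.* d) ∣                       ≡⟨ cong ℚ.∣_∣ (product-difference a b c d) ⟩
      ℚ.∣ a ℚ.* (b ℚ.- d) ℚ.+ d ℚ.* (a ℚ.- c) ∣           ≤⟨ ℚ.∣p+q∣≤∣p∣+∣q∣ (a ℚ.* (b ℚ.- d)) (d ℚ.* (a ℚ.- c)) ⟩
      ℚ.∣ a ℚ.* (b ℚ.- d) ∣ ℚ.+ ℚ.∣ d ℚ.* (a ℚ.- c) ∣     <⟨ ℚ.+-mono-<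
                                                               (prod a (b ℚ.- d) B 0<B (boundˣ m (≤₁ ≤m)) (closeʸ m n (≤₄ ≤m) (≤₄ ≤n)))
                                                               (prod d (a ℚ.- c) C 0<C (boundʸ n (≤₂ ≤n)) (closeˣ m n (≤₃ ≤m) (≤₃ ≤n))) ⟩
      B ℚ.* δ ℚ.+ C ℚ.* δ                                 ≡⟨ sym (ℚ.*-distribʳ-+ δ B C) ⟩
      (B ℚ.+ C) ℚ.* δ                                     ≡⟨ [B+C]δ≡ε ⟩
      ε                                                   ∎
      where
      open ℚ.≤-Reasoning
      a b c d : ℚ
      a = seq x m
      b = seq y m
      c = seq x n
      d = seq y n
      ≤₁₂ : ∀ {k} → (N₁ ⊔ N₂) ⊔ (N₃ ⊔ N₄) ℕ.≤ k → N₁ ⊔ N₂ ℕ.≤ k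
      ≤₁₂ = ℕ.m⊔n≤o⇒m≤o (N₁ ⊔ N₂) (N₃ ⊔ N₄)
      ≤₃₄ : ∀ {k} → (N₁ ⊔ N₂) ⊔ (N₃ ⊔ N₄) ℕ.≤ k → N₃ ⊔ N₄ ℕ.≤ k
      ≤₃₄ = ℕ.m⊔n≤o⇒n≤o (N₁ ⊔ N₂) (N₃ ⊔ N₄)
      ≤₁ : ∀ {k} → (N₁ ⊔ N₂) ⊔ (N₃ ⊔ N₄) ℕ.≤ k → N₁ ℕ.≤ k
      ≤₁ p = ℕ.m⊔n≤o⇒m≤o N₁ N₂ (≤₁₂ p)
      ≤₂ : ∀ {k} → (N₁ ⊔ N₂) ⊔ (N₃ ⊔ N₄) ℕ.≤ k → N₂ ℕ.≤ k
      ≤₂ p = ℕ.m⊔n≤o⇒n≤o N₁ N₂ (≤₁₂ p)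
      ≤₃ : ∀ {k} → (N₁ ⊔ N₂) ⊔ (N₃ ⊔ N₄) ℕ.≤ k → N₃ ℕ.≤ k
      ≤₃ p = ℕ.m⊔n≤o⇒m≤o N₃ N₄ (≤₃₄ p)
      ≤₄ : ∀ {k} → (N₁ ⊔ N₂) ⊔ (N₃ ⊔ N₄) ℕ.≤ k → N₄ ℕ.≤ k
      ≤₄ p = ℕ.m⊔n≤o⇒n≤o N₃ N₄ (≤₃₄ p)
      prod : ∀ p q D → 0ℚ ℚ.< D → ℚ.∣ p ∣ ℚ.≤ D → ℚ.∣ q ∣ ℚ.< δ →
             ℚ.∣ p ℚ.* q ∣ ℚ.< D ℚ.* δ
      prod p q D 0<D ∣p∣≤D ∣q∣<δ = begin-strict
        ℚ.∣ p ℚ.* q ∣           ≡⟨ ℚ.∣p*q∣≡∣p∣*∣q∣ p q ⟩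
        ℚ.∣ p ∣ ℚ.* ℚ.∣ q ∣     ≤⟨ ℚ.*-monoʳ-≤-nonNeg ℚ.∣ q ∣ {{ℚ.nonNegative (ℚ.0≤∣p∣ q)}} ∣p∣≤D ⟩
        D ℚ.* ℚ.∣ q ∣           <⟨ ℚ.*-monoʳ-<-pos D {{ℚ.positive 0<D}} ∣q∣<δ ⟩
        D ℚ.* δ                 ∎

infixl 6 _+_
infixl 7 _*_

0ℝ 1ℝ : ℝ
0ℝ = mkℝ (λ _ → 0ℚ) (const-cauchy 0ℚ)
1ℝ = mkℝ (λ _ → 1ℚ) (const-cauchy 1ℚ)

_+_ _*_ : ℝ → ℝ → ℝ
x + y = mkℝ (λ n → seq x n ℚ.+ seq y n) (+-cauchy x y)
x * y = mkℝ (λ n → seq x n ℚ.* seq y n) (*-cauchy x y)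

∑ : ∀ {n} → Vector ℝ n → ℝ
∑ = foldr _+_ 0ℝ

Matrix : ℕ → Set
Matrix n = Fin n → Fin n → ℝ

infixr 7 _*ᵥ_

_*ᵥ_ : ∀ {n} → Matrix n → Vector ℝ n → Vector ℝ n
(A *ᵥ x) i = ∑ (λ j → A i j * x j)

Nullspace : ∀ {n} → Matrix n → Pred (Vector ℝ n) 0ℓ
Nullspace A x = ∀ i → (A *ᵥ x) i ≈ 0ℝ

------------------------------------------------------------------------
-- Finite simple graphs on the vertex set Fin n

record Graph (n : ℕ) : Set₁ where
  field
    Adj    : Rel (Fin n) 0ℓ
    adj?   : Decidable Adj
    symm   : Symmetric Adj
    irrefl : Irreflexive _≡_ Adj

subsets : ∀ n → List (Subset n)
subsets zero    = [] ∷ []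
subsets (suc n) = map (inside ∷_) (subsets n) ++ map (outside ∷_) (subsets n)

module _ {n : ℕ} (G : Graph n) where

  open Graph G

  IsClique : Pred (Subset n) 0ℓ
  IsClique K = ∀ u v → u ∈ K → v ∈ K → u ≢ v → Adj u v

  IsIndependent : Pred (Subset n) 0ℓ
  IsIndependent I = ∀ u v → u ∈ I → v ∈ I → ¬ Adj u v

  isClique? : ∀ K → Dec (IsClique K)
  isClique? K = all? λ u → all? λ v →
    (u ∈? K) →-dec ((v ∈? K) →-dec (¬? (u ≟ v) →-dec adj? u v))

  isIndependent? : ∀ I → Dec (IsIndependent I)
  isIndependent? I = all? λ u → all? λ v →
    (u ∈? I) →-dec ((v ∈? I) →-dec ¬? (adj? u v))

  -- The default value 0 of max is harmless: the empty set always qualifies.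
  ω α : ℕ
  ω = max 0 (map ∣_∣ (filter isClique? (subsets n)))
  α = max 0 (map ∣_∣ (filter isIndependent? (subsets n)))

  IsMaximumIndependentSet : Pred (Subset n) 0ℓ
  IsMaximumIndependentSet I = IsIndependent I × ∣ I ∣ ≡ α

  record IsSPartition (K S : Subset n) : Set where
    field
      clique      : IsClique K
      independent : IsIndependent S
      disjoint    : Empty (K ∩ S)
      covers      : K ∪ S ≡ ⊤

  IsSplit : Set
  IsSplit = ℕ.NonZero n × ∃₂ IsSPartition

  IsBalancedPartition : (K S : Subset n) → Set
  IsBalancedPartition K S = ∣ K ∣ ≡ ω × ∣ S ∣ ≡ α

  -- Whether an s-partition is balanced does not depend on the s-partition,
  -- so being unbalanced may be witnessed by any one of them.
  IsUnbalanced : Set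
  IsUnbalanced = ∃₂ λ K S → IsSPartition K S × ¬ IsBalancedPartition K S

  adjacencyMatrix : Matrix n
  adjacencyMatrix i j = if does (adj? i j) then 1ℝ else 0ℝ

  Supp : Pred (Fin n) 0ℓ
  Supp v = ∃[ x ] (Nullspace adjacencyMatrix x × ¬ (x v ≈ 0ℝ))

  ⋂MaximumIndependentSets : Pred (Fin n) 0ℓ
  ⋂MaximumIndependentSets v = ∀ I → IsMaximumIndependentSet I → v ∈ I

{-# OPTIONS --safe #-}

-- An unbalanced split graph has a swing vertex w, which may be moved between the
-- two parts: N(w) is a clique and its complement S ∋ w is independent.  Let A x = 0
-- with A the adjacency matrix.  For k in N(w), subtracting row k from row w gives
-- x_k = ∑ x_s over the neighbours s of k in S; multiplying by x_k and summing,
-- rows s ∈ S yield ∑_{k ∈ N(w)} x_k² = 0, so x vanishes on N(w).  A maximum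
-- independent set that misses some v ∈ S has the form S - v + k with k ∈ N(w), and
-- as k is adjacent to w this forces v = w, with w the only neighbour of k in S;
-- then x_w = x_k = 0.
--
-- Reals are Cauchy sequences, so the computation is done termwise in ℚ, with
-- sequences tending to 0 in place of exact zeros.

module Submission where

open import Defs
open import Algebra.Bundles using (CommutativeRing)
import Algebra.Properties.Semiring.Sum as SemiringSum
open import Data.Bool.Base using (if_then_else_)
open import Data.Bool.Properties using (if-float)
open import Data.Fin.Base using (Fin; zero; suc)
open import Data.Fin.Properties using (_≟_; any?)
open import Data.Fin.Subset using (Subset; inside; outside; _∈_; _∉_; _-_; ⁅_⁆; ∣_∣)
  renaming (_⊆_ to _⊆ₛ_)
open import Data.Fin.Subset.Properties
  using (_∈?_; ∈⊤; p⊆q⇒∣p∣≤∣q∣; p⊂q⇒∣p∣<∣q∣; x∈p∪q⁻; p─⊥≡p; p─q⊆p; x∈p∧x≢y⇒x∈p-y; x∈p⇒∣p-x∣<∣p∣)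
open import Data.List.Base using (map; filter)
open import Data.List.Extrema.Nat using (max; xs≤max; argmax-sel)
open import Data.List.Membership.Propositional using () renaming (_∈_ to _∈ₗ_)
open import Data.List.Membership.Propositional.Properties
  using (∈-map⁺; ∈-map⁻; ∈-++⁺ˡ; ∈-++⁺ʳ; ∈-filter⁺; ∈-filter⁻)
import Data.List.Relation.Unary.All as All
import Data.List.Relation.Unary.Any as Any
open import Data.Nat.Base as ℕ using (ℕ; _⊔_)
import Data.Nat.Properties as ℕ
open import Data.Product.Base using (∃-syntax; _×_; _,_)
open import Data.Rational.Base as ℚ using (ℚ; 0ℚ; 1ℚ; ½)
import Data.Rational.Properties as ℚ
import Data.Rational.Solver as ℚ
open import Data.Sum.Base using (inj₁; inj₂)
open import Data.Vec.Base using ([]; _∷_; there; tabulate)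
open import Data.Vec.Properties using (lookup∘tabulate; lookup⇒[]=; []=⇒lookup)
open import Data.Vec.Functional using (Vector)
open import Level using (0ℓ)
open import Function.Base using (_∘_; id)
open import Relation.Binary.PropositionalEquality
  using (_≡_; _≢_; refl; sym; trans; cong; cong₂; subst; module ≡-Reasoning)
open import Relation.Nullary.Decidable using (Dec; yes; no; does; dec-true; decidable-stable; ¬?; _×-dec_)
open import Relation.Nullary.Negation using (¬_; contradiction)
open import Relation.Unary using (Pred; Decidable; _⊆_)

-- Null sequences

-- A record rather than a function, so that s can be inferred from IsNull s.
record IsNull (s : ℕ → ℚ) : Set where
  constructor mkNull
  field
    eventually< : ∀ ε → 0ℚ ℚ.< ε → ∃[ N ] (∀ n → N ℕ.≤ n → ℚ.∣ s n ∣ ℚ.< ε)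

open IsNull

≈0⇒null : ∀ x → x ≈ 0ℝ → IsNull (seq x)
≈0⇒null x x≈0 = mkNull λ ε 0<ε → let N , close = x≈0 ε 0<ε in N , λ n N≤n →
  subst (λ p → ℚ.∣ p ∣ ℚ.< ε) (ℚ.+-identityʳ (seq x n)) (close n N≤n)

null⇒≈0 : ∀ x → IsNull (seq x) → x ≈ 0ℝ
null⇒≈0 x null ε 0<ε = let N , small = eventually< null ε 0<ε in N , λ n N≤n →
  subst (λ p → ℚ.∣ p ∣ ℚ.< ε) (sym (ℚ.+-identityʳ (seq x n))) (small n N≤n)

null-dominated : ∀ {s t} → IsNull t → (∀ n → ℚ.∣ s n ∣ ℚ.≤ ℚ.∣ t n ∣) → IsNull s
null-dominated null s≤t = mkNull λ ε 0<ε → let N , small = eventually< null ε 0<ε in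
  N , λ n N≤n → ℚ.≤-<-trans (s≤t n) (small n N≤n)

null-cong : ∀ {s t} → IsNull s → (∀ n → s n ≡ t n) → IsNull t
null-cong null s≡t = null-dominated null (λ n → ℚ.≤-reflexive (cong ℚ.∣_∣ (sym (s≡t n))))

null-0 : IsNull (λ _ → 0ℚ)
null-0 = mkNull λ ε 0<ε → 0 , λ _ _ → 0<ε

null-neg : ∀ {s} → IsNull s → IsNull (λ n → ℚ.- s n)
null-neg {s} null = null-dominated null (λ n → ℚ.≤-reflexive (ℚ.∣-p∣≡∣p∣ (s n)))

null-+ : ∀ {s t} → IsNull s → IsNull t → IsNull (λ n → s n ℚ.+ t n)
null-+ {s} {t} nullₛ nullₜ = mkNull λ ε 0<ε →
  let N , smallₛ = eventually< nullₛ (½ ℚ.* ε) (0<½* 0<ε)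
      M , smallₜ = eventually< nullₜ (½ ℚ.* ε) (0<½* 0<ε)
  in N ⊔ M , λ n N⊔M≤n →
    ℚ.≤-<-trans (ℚ.∣p+q∣≤∣p∣+∣q∣ (s n) (t n))
      (subst (ℚ.∣ s n ∣ ℚ.+ ℚ.∣ t n ∣ ℚ.<_) (halves ε)
        (ℚ.+-mono-< (smallₛ n (ℕ.m⊔n≤o⇒m≤o N M N⊔M≤n)) (smallₜ n (ℕ.m⊔n≤o⇒n≤o N M N⊔M≤n))))
  where
  0<½* : ∀ {ε} → 0ℚ ℚ.< ε → 0ℚ ℚ.< ½ ℚ.* ε
  0<½* {ε} 0<ε = ℚ.positive⁻¹ _ {{ℚ.pos*pos⇒pos ½ ε {{ℚ.positive 0<ε}}}}
  halves : ∀ ε → ½ ℚ.* ε ℚ.+ ½ ℚ.* ε ≡ ε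
  halves ε = trans (sym (ℚ.*-distribʳ-+ ε ½ ½)) (ℚ.*-identityˡ ε)

seq-bounded : ∀ x → ∃[ B ] (0ℚ ℚ.< B × ∃[ N ] (∀ n → N ℕ.≤ n → ℚ.∣ seq x n ∣ ℚ.≤ B))
seq-bounded x with cauchy x 1ℚ (ℚ.positive⁻¹ 1ℚ)
... | N , close = 1ℚ ℚ.+ ℚ.∣ a ∣ , ℚ.+-mono-<-≤ (ℚ.positive⁻¹ 1ℚ) (ℚ.0≤∣p∣ a) , N , bound
  where
  open ℚ.≤-Reasoning
  open ℚ.+-*-Solver
  a = seq x N
  bound : ∀ n → N ℕ.≤ n → ℚ.∣ seq x n ∣ ℚ.≤ 1ℚ ℚ.+ ℚ.∣ a ∣
  bound n N≤n = begin
    ℚ.∣ seq x n ∣                    ≡⟨ cong ℚ.∣_∣ (solve 2 (λ p q → p := p :- q :+ q) refl (seq x n) a) ⟩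
    ℚ.∣ (seq x n ℚ.- a) ℚ.+ a ∣      ≤⟨ ℚ.∣p+q∣≤∣p∣+∣q∣ (seq x n ℚ.- a) a ⟩
    ℚ.∣ seq x n ℚ.- a ∣ ℚ.+ ℚ.∣ a ∣  ≤⟨ ℚ.+-monoˡ-≤ ℚ.∣ a ∣ (ℚ.<⇒≤ (close n N N≤n ℕ.≤-refl)) ⟩
    1ℚ ℚ.+ ℚ.∣ a ∣                   ∎

divide : ∀ c ε → 0ℚ ℚ.< c → 0ℚ ℚ.< ε → ∃[ δ ] (0ℚ ℚ.< δ × c ℚ.* δ ≡ ε)
divide c ε 0<c 0<ε = 1/c ℚ.* ε , ℚ.positive⁻¹ _ {{positive}} , eq
  where
  instance
    c-positive : ℚ.Positive c
    c-positive = ℚ.positive 0<c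
    c-nonZero : ℚ.NonZero c
    c-nonZero = ℚ.pos⇒nonZero c
  1/c : ℚ
  1/c = ℚ.1/ c
  positive : ℚ.Positive (1/c ℚ.* ε)
  positive = ℚ.pos*pos⇒pos 1/c {{ℚ.1/pos⇒pos c}} ε {{ℚ.positive 0<ε}}
  eq : c ℚ.* (1/c ℚ.* ε) ≡ ε
  eq = trans (sym (ℚ.*-assoc c 1/c ε))
    (trans (cong (ℚ._* ε) (ℚ.*-inverseʳ c)) (ℚ.*-identityˡ ε))

∣p*q∣<c*d : ∀ p q {c d} → 0ℚ ℚ.< c → ℚ.∣ p ∣ ℚ.≤ c → ℚ.∣ q ∣ ℚ.< d → ℚ.∣ p ℚ.* q ∣ ℚ.< c ℚ.* d
∣p*q∣<c*d p q {c} {d} 0<c ∣p∣≤c ∣q∣<d = begin-strict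
  ℚ.∣ p ℚ.* q ∣        ≡⟨ ℚ.∣p*q∣≡∣p∣*∣q∣ p q ⟩
  ℚ.∣ p ∣ ℚ.* ℚ.∣ q ∣  ≤⟨ ℚ.*-monoʳ-≤-nonNeg ℚ.∣ q ∣ {{ℚ.nonNegative (ℚ.0≤∣p∣ q)}} ∣p∣≤c ⟩
  c ℚ.* ℚ.∣ q ∣        <⟨ ℚ.*-monoʳ-<-pos c {{ℚ.positive 0<c}} ∣q∣<d ⟩
  c ℚ.* d              ∎
  where open ℚ.≤-Reasoning

-- The factor `x` is a real because a Cauchy sequence is eventually bounded by some B; then terms of
-- `s` below ε / B suffice.
null-* : ∀ x {s} → IsNull s → IsNull (λ n → seq x n ℚ.* s n)
null-* x {s} null = mkNull λ ε 0<ε →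
  let B , 0<B , N , bound = seq-bounded x
      δ , 0<δ , Bδ≡ε = divide B ε 0<B 0<ε
      M , small = eventually< null δ 0<δ
  in N ⊔ M , λ n N⊔M≤n → subst (ℚ.∣ seq x n ℚ.* s n ∣ ℚ.<_) Bδ≡ε
    (∣p*q∣<c*d (seq x n) (s n) 0<B
      (bound n (ℕ.m⊔n≤o⇒m≤o N M N⊔M≤n)) (small n (ℕ.m⊔n≤o⇒n≤o N M N⊔M≤n)))

-- No square root is taken: the squares are pushed below ε * ε, and ε ≤ ∣ s n ∣ would make the
-- square at least that large.
null-square⁻¹ : ∀ {s} → IsNull (λ n → s n ℚ.* s n) → IsNull s
null-square⁻¹ {s} null = mkNull λ ε 0<ε →
  let N , small = eventually< null (ε ℚ.* ε) (0<ε*ε ε 0<ε)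
  in N , λ n N≤n → ℚ.≰⇒> (λ ε≤∣s∣ → ℚ.<-irrefl refl (ℚ.<-≤-trans (small n N≤n) (large ε 0<ε (s n) ε≤∣s∣)))
  where
  open ℚ.≤-Reasoning
  0<ε*ε : ∀ ε → 0ℚ ℚ.< ε → 0ℚ ℚ.< ε ℚ.* ε
  0<ε*ε ε 0<ε = ℚ.positive⁻¹ _ {{ℚ.pos*pos⇒pos ε {{ℚ.positive 0<ε}} ε {{ℚ.positive 0<ε}}}}
  large : ∀ ε → 0ℚ ℚ.< ε → ∀ p → ε ℚ.≤ ℚ.∣ p ∣ → ε ℚ.* ε ℚ.≤ ℚ.∣ p ℚ.* p ∣
  large ε 0<ε p ε≤∣p∣ = begin
    ε ℚ.* ε              ≤⟨ ℚ.*-monoʳ-≤-nonNeg ε {{ℚ.nonNegative (ℚ.<⇒≤ 0<ε)}} ε≤∣p∣ ⟩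
    ℚ.∣ p ∣ ℚ.* ε        ≤⟨ ℚ.*-monoˡ-≤-nonNeg ℚ.∣ p ∣ {{ℚ.nonNegative (ℚ.0≤∣p∣ p)}} ε≤∣p∣ ⟩
    ℚ.∣ p ∣ ℚ.* ℚ.∣ p ∣  ≡⟨ ℚ.∣p*q∣≡∣p∣*∣q∣ p p ⟨
    ℚ.∣ p ℚ.* p ∣        ∎

-- Finite sums of rationals

open SemiringSum (CommutativeRing.semiring ℚ.+-*-commutativeRing)
  using (sum; sum-cong-≗; sum-replicate-zero; ∑-distrib-+; ∑-comm; *-distribˡ-sum)

seq-∑ : ∀ {m} (f : Vector ℝ m) n → seq (∑ f) n ≡ sum (λ i → seq (f i) n)
seq-∑ {ℕ.zero}  f n = refl
seq-∑ {ℕ.suc m} f n = cong (seq (f zero) n ℚ.+_) (seq-∑ (f ∘ suc) n)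

null-sum : ∀ {m} {f : Fin m → ℕ → ℚ} → (∀ i → IsNull (f i)) → IsNull (λ n → sum (λ i → f i n))
null-sum {ℕ.zero}      null = null-0
null-sum {ℕ.suc m} {f} null = null-+ {f zero} (null zero) (null-sum (null ∘ suc))

sum-nonNeg : ∀ {m} (f : Vector ℚ m) → (∀ i → 0ℚ ℚ.≤ f i) → 0ℚ ℚ.≤ sum f
sum-nonNeg {ℕ.zero}  f 0≤f = ℚ.≤-refl
sum-nonNeg {ℕ.suc m} f 0≤f = ℚ.+-mono-≤ (0≤f zero) (sum-nonNeg (f ∘ suc) (0≤f ∘ suc))

term≤sum : ∀ {m} (f : Vector ℚ m) → (∀ i → 0ℚ ℚ.≤ f i) → ∀ i → f i ℚ.≤ sum f
term≤sum f 0≤f zero = subst (ℚ._≤ sum f) (ℚ.+-identityʳ (f zero))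
  (ℚ.+-monoʳ-≤ (f zero) (sum-nonNeg (f ∘ suc) (0≤f ∘ suc)))
term≤sum f 0≤f (suc i) = subst (ℚ._≤ sum f) (ℚ.+-identityˡ (f (suc i)))
  (ℚ.+-mono-≤ (0≤f zero) (term≤sum (f ∘ suc) (0≤f ∘ suc) i))

0≤p*p : ∀ p → 0ℚ ℚ.≤ p ℚ.* p
0≤p*p p = subst (0ℚ ℚ.≤_) ∣p∣*∣p∣≡p*p
  (ℚ.nonNegative⁻¹ _ {{ℚ.nonNeg*nonNeg⇒nonNeg ℚ.∣ p ∣ {{ℚ.nonNegative (ℚ.0≤∣p∣ p)}} ℚ.∣ p ∣ {{ℚ.nonNegative (ℚ.0≤∣p∣ p)}}}})
  where
  open ℚ.+-*-Solver
  ∣p∣*∣p∣≡p*p : ℚ.∣ p ∣ ℚ.* ℚ.∣ p ∣ ≡ p ℚ.* p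
  ∣p∣*∣p∣≡p*p with ℚ.∣p∣≡p∨∣p∣≡-p p
  ... | inj₁ eq = cong₂ ℚ._*_ eq eq
  ... | inj₂ eq = trans (cong₂ ℚ._*_ eq eq) (solve 1 (λ q → :- q :* :- q := q :* q) refl p)

-- Indicators and the quadratic form of a split matrix

[_] : ∀ {A : Set} → Dec A → ℚ
[ a? ] = if does a? then 1ℚ else 0ℚ

0≤[]* : ∀ {A : Set} (a? : Dec A) {p} → 0ℚ ℚ.≤ p → 0ℚ ℚ.≤ [ a? ] ℚ.* p
0≤[]* (yes _) {p} 0≤p = subst (0ℚ ℚ.≤_) (sym (ℚ.*-identityˡ p)) 0≤p
0≤[]* (no _)  {p} 0≤p = ℚ.≤-reflexive (sym (ℚ.*-zeroˡ p))

sum-δ : ∀ {m} i (y : Vector ℚ m) → sum (λ j → [ i ≟ j ] ℚ.* y j) ≡ y i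
sum-δ {ℕ.suc m} zero y = trans
  (cong₂ ℚ._+_ (ℚ.*-identityˡ (y zero))
    (trans (sum-cong-≗ (λ j → ℚ.*-zeroˡ (y (suc j)))) (sum-replicate-zero m)))
  (ℚ.+-identityʳ (y zero))
sum-δ (suc i) y = trans
  (cong₂ ℚ._+_ (ℚ.*-zeroˡ (y zero)) (sum-δ i (y ∘ suc)))
  (ℚ.+-identityˡ (y (suc i)))

-- The hypothesis on A says, for weights k in {0, 1}: ones off the diagonal and zeros
-- on it in the block k = 1, zeros in the block k = 0.
weighted-squares : ∀ {m} (A : Fin m → Fin m → ℚ) (k x : Vector ℚ m) →
  (∀ i j → A i j ≡ A j i) →
  (∀ i j → A i j ℚ.+ k i ℚ.* k j ≡ (k i ℚ.+ k j) ℚ.* A i j ℚ.+ [ i ≟ j ] ℚ.* k j) →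
  let Ax = λ i → sum (λ j → A i j ℚ.* x j)
      kx = sum (λ j → k j ℚ.* x j)
      q  = sum (λ i → k i ℚ.* (x i ℚ.* Ax i))
  in sum (λ i → x i ℚ.* Ax i) ℚ.+ kx ℚ.* kx ℚ.+ ℚ.- (q ℚ.+ q) ≡ sum (λ i → k i ℚ.* (x i ℚ.* x i))
weighted-squares {m} A k x A-sym A-split = begin
  sum (λ i → x i ℚ.* Ax i) ℚ.+ kx ℚ.* kx ℚ.+ ℚ.- (q ℚ.+ q)
    ≡⟨ cong (ℚ._+ ℚ.- (q ℚ.+ q)) total ⟩
  q ℚ.+ q′ ℚ.+ sum kxx ℚ.+ ℚ.- (q ℚ.+ q)
    ≡⟨ cong (λ p → q ℚ.+ p ℚ.+ sum kxx ℚ.+ ℚ.- (q ℚ.+ q)) transpose ⟩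
  q ℚ.+ q ℚ.+ sum kxx ℚ.+ ℚ.- (q ℚ.+ q)
    ≡⟨ solve 2 (λ s q → q :+ q :+ s :+ :- (q :+ q) := s) refl (sum kxx) q ⟩
  sum kxx
    ∎
  where
  open ≡-Reasoning
  open ℚ.+-*-Solver
  Ax Akx kxx : Vector ℚ m
  Ax  i = sum (λ j → A i j ℚ.* x j)
  Akx i = sum (λ j → A i j ℚ.* (k j ℚ.* x j))
  kxx i = k i ℚ.* (x i ℚ.* x i)
  kx q q′ : ℚ
  kx = sum (λ j → k j ℚ.* x j)
  q  = sum (λ i → k i ℚ.* (x i ℚ.* Ax i))
  q′ = sum (λ i → x i ℚ.* Akx i)

  -- Both are the bilinear form of A at x and the vector of entries k j * x j; symmetry of A and an
  -- exchange of summations swap its arguments.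
  transpose : q′ ≡ q
  transpose = begin
    sum (λ i → x i ℚ.* Akx i)
      ≡⟨ sum-cong-≗ (λ i → *-distribˡ-sum (x i) (λ j → A i j ℚ.* (k j ℚ.* x j))) ⟩
    sum (λ i → sum (λ j → x i ℚ.* (A i j ℚ.* (k j ℚ.* x j))))
      ≡⟨ ∑-comm (λ i j → x i ℚ.* (A i j ℚ.* (k j ℚ.* x j))) ⟩
    sum (λ j → sum (λ i → x i ℚ.* (A i j ℚ.* (k j ℚ.* x j))))
      ≡⟨ sum-cong-≗ (λ j → sum-cong-≗ (λ i → trans
           (cong (λ a → x i ℚ.* (a ℚ.* (k j ℚ.* x j))) (A-sym i j))
           (solve 4 (λ xᵢ a kⱼ xⱼ → xᵢ :* (a :* (kⱼ :* xⱼ)) := kⱼ :* (xⱼ :* (a :* xᵢ))) refl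
             (x i) (A j i) (k j) (x j)))) ⟩
    sum (λ j → sum (λ i → k j ℚ.* (x j ℚ.* (A j i ℚ.* x i))))
      ≡⟨ sum-cong-≗ (λ j → trans (cong (k j ℚ.*_) (*-distribˡ-sum (x j) (λ i → A j i ℚ.* x i)))
           (*-distribˡ-sum (k j) (λ i → x j ℚ.* (A j i ℚ.* x i)))) ⟨
    q ∎

  -- `A-split i j` times x j, summed over j; the indicator of i = j leaves only the diagonal term k
  -- i * x i.
  row : ∀ i → Ax i ℚ.+ k i ℚ.* kx ≡ (k i ℚ.* Ax i ℚ.+ Akx i) ℚ.+ k i ℚ.* x i
  row i = begin
    Ax i ℚ.+ k i ℚ.* kx
      ≡⟨ cong (Ax i ℚ.+_) (*-distribˡ-sum (k i) (λ j → k j ℚ.* x j)) ⟩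
    Ax i ℚ.+ sum (λ j → k i ℚ.* (k j ℚ.* x j))
      ≡⟨ ∑-distrib-+ (λ j → A i j ℚ.* x j) (λ j → k i ℚ.* (k j ℚ.* x j)) ⟨
    sum (λ j → A i j ℚ.* x j ℚ.+ k i ℚ.* (k j ℚ.* x j))
      ≡⟨ sum-cong-≗ entry ⟩
    sum (λ j → k i ℚ.* (A i j ℚ.* x j) ℚ.+ A i j ℚ.* (k j ℚ.* x j) ℚ.+ [ i ≟ j ] ℚ.* (k j ℚ.* x j))
      ≡⟨ ∑-distrib-+ (λ j → k i ℚ.* (A i j ℚ.* x j) ℚ.+ A i j ℚ.* (k j ℚ.* x j)) _ ⟩
    sum (λ j → k i ℚ.* (A i j ℚ.* x j) ℚ.+ A i j ℚ.* (k j ℚ.* x j)) ℚ.+ sum (λ j → [ i ≟ j ] ℚ.* (k j ℚ.* x j))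
      ≡⟨ cong₂ ℚ._+_ (∑-distrib-+ (λ j → k i ℚ.* (A i j ℚ.* x j)) _) (sum-δ i (λ j → k j ℚ.* x j)) ⟩
    (sum (λ j → k i ℚ.* (A i j ℚ.* x j)) ℚ.+ Akx i) ℚ.+ k i ℚ.* x i
      ≡⟨ cong (λ p → (p ℚ.+ Akx i) ℚ.+ k i ℚ.* x i) (sym (*-distribˡ-sum (k i) (λ j → A i j ℚ.* x j))) ⟩
    (k i ℚ.* Ax i ℚ.+ Akx i) ℚ.+ k i ℚ.* x i ∎
    where
    entry : ∀ j → A i j ℚ.* x j ℚ.+ k i ℚ.* (k j ℚ.* x j) ≡
                  k i ℚ.* (A i j ℚ.* x j) ℚ.+ A i j ℚ.* (k j ℚ.* x j) ℚ.+ [ i ≟ j ] ℚ.* (k j ℚ.* x j)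
    entry j = begin
      A i j ℚ.* x j ℚ.+ k i ℚ.* (k j ℚ.* x j)
        ≡⟨ solve 4 (λ a kᵢ kⱼ xⱼ → a :* xⱼ :+ kᵢ :* (kⱼ :* xⱼ) := (a :+ kᵢ :* kⱼ) :* xⱼ) refl
             (A i j) (k i) (k j) (x j) ⟩
      (A i j ℚ.+ k i ℚ.* k j) ℚ.* x j
        ≡⟨ cong (ℚ._* x j) (A-split i j) ⟩
      ((k i ℚ.+ k j) ℚ.* A i j ℚ.+ [ i ≟ j ] ℚ.* k j) ℚ.* x j
        ≡⟨ solve 5 (λ a kᵢ kⱼ d xⱼ → ((kᵢ :+ kⱼ) :* a :+ d :* kⱼ) :* xⱼ
                                   := kᵢ :* (a :* xⱼ) :+ a :* (kⱼ :* xⱼ) :+ d :* (kⱼ :* xⱼ)) refl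
             (A i j) (k i) (k j) [ i ≟ j ] (x j) ⟩
      k i ℚ.* (A i j ℚ.* x j) ℚ.+ A i j ℚ.* (k j ℚ.* x j) ℚ.+ [ i ≟ j ] ℚ.* (k j ℚ.* x j) ∎

  -- `row i` times x i, summed over i.
  total : sum (λ i → x i ℚ.* Ax i) ℚ.+ kx ℚ.* kx ≡ q ℚ.+ q′ ℚ.+ sum kxx
  total = begin
    sum (λ i → x i ℚ.* Ax i) ℚ.+ kx ℚ.* kx
      ≡⟨ cong (sum (λ i → x i ℚ.* Ax i) ℚ.+_) (*-distribˡ-sum kx (λ i → k i ℚ.* x i)) ⟩
    sum (λ i → x i ℚ.* Ax i) ℚ.+ sum (λ i → kx ℚ.* (k i ℚ.* x i))
      ≡⟨ ∑-distrib-+ (λ i → x i ℚ.* Ax i) _ ⟨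
    sum (λ i → x i ℚ.* Ax i ℚ.+ kx ℚ.* (k i ℚ.* x i))
      ≡⟨ sum-cong-≗ entry ⟩
    sum (λ i → k i ℚ.* (x i ℚ.* Ax i) ℚ.+ x i ℚ.* Akx i ℚ.+ kxx i)
      ≡⟨ ∑-distrib-+ (λ i → k i ℚ.* (x i ℚ.* Ax i) ℚ.+ x i ℚ.* Akx i) kxx ⟩
    sum (λ i → k i ℚ.* (x i ℚ.* Ax i) ℚ.+ x i ℚ.* Akx i) ℚ.+ sum kxx
      ≡⟨ cong (ℚ._+ sum kxx) (∑-distrib-+ (λ i → k i ℚ.* (x i ℚ.* Ax i)) _) ⟩
    q ℚ.+ q′ ℚ.+ sum kxx ∎
    where
    entry : ∀ i → x i ℚ.* Ax i ℚ.+ kx ℚ.* (k i ℚ.* x i) ≡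
                  k i ℚ.* (x i ℚ.* Ax i) ℚ.+ x i ℚ.* Akx i ℚ.+ kxx i
    entry i = begin
      x i ℚ.* Ax i ℚ.+ kx ℚ.* (k i ℚ.* x i)
        ≡⟨ solve 4 (λ xᵢ b s kᵢ → xᵢ :* b :+ s :* (kᵢ :* xᵢ) := xᵢ :* (b :+ kᵢ :* s)) refl
             (x i) (Ax i) kx (k i) ⟩
      x i ℚ.* (Ax i ℚ.+ k i ℚ.* kx)
        ≡⟨ cong (x i ℚ.*_) (row i) ⟩
      x i ℚ.* ((k i ℚ.* Ax i ℚ.+ Akx i) ℚ.+ k i ℚ.* x i)
        ≡⟨ solve 4 (λ xᵢ b c kᵢ → xᵢ :* ((kᵢ :* b :+ c) :+ kᵢ :* xᵢ)
                                := kᵢ :* (xᵢ :* b) :+ xᵢ :* c :+ kᵢ :* (xᵢ :* xᵢ)) refl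
             (x i) (Ax i) (Akx i) (k i) ⟩
      k i ℚ.* (x i ℚ.* Ax i) ℚ.+ x i ℚ.* Akx i ℚ.+ kxx i ∎

-- Finite sets

ofPredicate : ∀ {n} {P : Pred (Fin n) 0ℓ} → Decidable P → Subset n
ofPredicate P? = tabulate (does ∘ P?)

∈-ofPredicate⁺ : ∀ {n} {P : Pred (Fin n) 0ℓ} (P? : Decidable P) {v} → P v → v ∈ ofPredicate P?
∈-ofPredicate⁺ P? {v} pv = lookup⇒[]= v _ (trans (lookup∘tabulate _ v) (dec-true (P? v) pv))

∈-ofPredicate⁻ : ∀ {n} {P : Pred (Fin n) 0ℓ} (P? : Decidable P) {v} → v ∈ ofPredicate P? → P v
∈-ofPredicate⁻ P? {v} v∈ with P? v | trans (sym (lookup∘tabulate (does ∘ P?) v)) ([]=⇒lookup v∈)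
... | yes pv | _ = pv

x∉p-x : ∀ {n} (p : Subset n) x → x ∉ p - x
-- The case x = zero is vacuous, as the head of `p - zero` computes to `outside`.
x∉p-x (s ∷ p) (suc x) (there x∈) = x∉p-x p x x∈

∣p∣≤1+∣p-x∣ : ∀ {n} (p : Subset n) x → ∣ p ∣ ℕ.≤ ℕ.suc ∣ p - x ∣
∣p∣≤1+∣p-x∣ (inside  ∷ p) zero    = ℕ.s≤s (ℕ.≤-reflexive (cong ∣_∣ (sym (p─⊥≡p p))))
∣p∣≤1+∣p-x∣ (outside ∷ p) zero    = ℕ.m≤n⇒m≤1+n (ℕ.≤-reflexive (cong ∣_∣ (sym (p─⊥≡p p))))
∣p∣≤1+∣p-x∣ (inside  ∷ p) (suc x) = ℕ.s≤s (∣p∣≤1+∣p-x∣ p x)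
∣p∣≤1+∣p-x∣ (outside ∷ p) (suc x) = ∣p∣≤1+∣p-x∣ p x

-- If w is the only element of p outside q, then p - w lies in q and has at least ∣ q ∣ elements, so
-- it is all of q. Thus p = q + w.
one-excess : ∀ {n} (p q : Subset n) →
  (∀ {u v} → u ∈ p → u ∉ q → v ∈ p → v ∉ q → u ≡ v) → ∣ q ∣ ℕ.< ∣ p ∣ →
  q ⊆ₛ p × ∃[ w ] (w ∈ p × w ∉ q)
one-excess p q unique ∣q∣<∣p∣ with any? (λ w → (w ∈? p) ×-dec ¬? (w ∈? q))
... | no none = contradiction (p⊆q⇒∣p∣≤∣q∣ p⊆q) (ℕ.<⇒≱ ∣q∣<∣p∣)
  where
  p⊆q : p ⊆ₛ q
  p⊆q {u} u∈p = decidable-stable (u ∈? q) (λ u∉q → none (u , u∈p , u∉q))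
... | yes (w , w∈p , w∉q) = q⊆p , w , w∈p , w∉q
  where
  p-w⊆q : (p - w) ⊆ₛ q
  p-w⊆q {u} u∈p-w = decidable-stable (u ∈? q) λ u∉q →
    x∉p-x p w (subst (_∈ p - w) (unique (p─q⊆p p ⁅ w ⁆ u∈p-w) u∉q w∈p w∉q) u∈p-w)
  q⊆p : q ⊆ₛ p
  -- An element of q outside p would make p - w a proper subset of q, giving ∣ p ∣ ≤ 1 + ∣ p - w ∣ ≤
  -- ∣ q ∣.
  q⊆p {u} u∈q = decidable-stable (u ∈? p) λ u∉p →
    ℕ.<⇒≱ ∣q∣<∣p∣ (ℕ.≤-trans (∣p∣≤1+∣p-x∣ p w)
      (p⊂q⇒∣p∣<∣q∣ (p-w⊆q , u , u∈q , u∉p ∘ p─q⊆p p ⁅ w ⁆)))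

∈-subsets : ∀ {n} (p : Subset n) → p ∈ₗ subsets n
∈-subsets []                  = Any.here refl
∈-subsets (inside  ∷ p)       = ∈-++⁺ˡ (∈-map⁺ (inside ∷_) (∈-subsets p))
∈-subsets {ℕ.suc n} (outside ∷ p) = ∈-++⁺ʳ (map (inside ∷_) (subsets n)) (∈-map⁺ (outside ∷_) (∈-subsets p))

module _ {n} {P : Pred (Subset n) 0ℓ} (P? : Decidable P) where

  -- Unfolds to ω for `isClique? G` and to α for `isIndependent? G`, so one treatment serves both.
  maxSize : ℕ
  maxSize = max 0 (map ∣_∣ (filter P? (subsets n)))

  size≤maxSize : ∀ {p} → P p → ∣ p ∣ ℕ.≤ maxSize
  size≤maxSize {p} Pp = All.lookup (xs≤max 0 _) (∈-map⁺ ∣_∣ (∈-filter⁺ P? (∈-subsets p) Pp))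

  larger : ∀ {p} → P p → ∣ p ∣ ≢ maxSize → ∃[ q ] (P q × ∣ p ∣ ℕ.< ∣ q ∣)
  larger {p} Pp ≢max with ℕ.≤∧≢⇒< (size≤maxSize Pp) ≢max | argmax-sel id 0 (map ∣_∣ (filter P? (subsets n)))
  -- The maximum is either the default 0 or attained in the list; the default is excluded because ∣
  -- p ∣ lies strictly below the maximum.
  ... | <max | inj₁ max≡0 = contradiction (subst (∣ p ∣ ℕ.<_) max≡0 <max) ℕ.n≮0
  ... | <max | inj₂ max∈ with ∈-map⁻ ∣_∣ max∈
  ... | q , q∈ , max≡∣q∣ with ∈-filter⁻ P? {xs = subsets n} q∈
  ... | _ , Pq = q , Pq , subst (∣ p ∣ ℕ.<_) max≡∣q∣ <max

-- Swing vertices and maximum independent sets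

module _ {n} (G : Graph n) where

  open Graph G

  -- Phrased through adjacency to w alone, so that no partition has to be carried along: N(w) and
  -- its complement form an s-partition with w on the independent side, and w can change sides
  -- because N(w) + w is again a clique.
  record IsSwing (w : Fin n) : Set where
    field
      neighbours-clique         : ∀ {u v} → Adj w u → Adj w v → u ≢ v → Adj u v
      nonNeighbours-independent : ∀ {u v} → ¬ Adj w u → ¬ Adj w v → ¬ Adj u v

  -- Provides the uniqueness hypothesis of `one-excess` in both cases of `swing-vertex`.
  clique-∩-independent : ∀ {C I} → IsClique G C → IsIndependent G I →
    ∀ {u v} → u ∈ C → u ∈ I → v ∈ C → v ∈ I → u ≡ v
  clique-∩-independent cl ind {u} {v} u∈C u∈I v∈C v∈I = decidable-stable (u ≟ v)
    (λ u≢v → ind u v u∈I v∈I (cl u v u∈C v∈C u≢v))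

  -- Either K is smaller than some clique or S is smaller than some independent set. The larger set
  -- exceeds its part by exactly one vertex, and that vertex is the swing vertex.
  swing-vertex : IsUnbalanced G → ∃[ w ] IsSwing w
  swing-vertex (K , S , isSPartition , unbalanced) = by-deficiency (∣ K ∣ ℕ.≟ ω G)
    where
    open IsSPartition isSPartition
    ∉K⇒∈S : ∀ {u} → u ∉ K → u ∈ S
    ∉K⇒∈S {u} u∉K with x∈p∪q⁻ K S (subst (u ∈_) (sym covers) ∈⊤)
    ... | inj₁ u∈K = contradiction u∈K u∉K
    ... | inj₂ u∈S = u∈S
    ∉S⇒∈K : ∀ {u} → u ∉ S → u ∈ K
    ∉S⇒∈K {u} u∉S = decidable-stable (u ∈? K) (u∉S ∘ ∉K⇒∈S)

    from-clique : ∀ {C} → IsClique G C → ∣ K ∣ ℕ.< ∣ C ∣ → ∃[ w ] IsSwing w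
    from-clique {C} cl ∣K∣<∣C∣ with one-excess C K
      (λ u∈C u∉K v∈C v∉K → clique-∩-independent cl independent u∈C (∉K⇒∈S u∉K) v∈C (∉K⇒∈S v∉K)) ∣K∣<∣C∣
    -- Here C = K + w with w in S, so N(w) = K and its complement is S.
    ... | K⊆C , w , w∈C , w∉K = w , record
      { neighbours-clique = λ wu wv u≢v → clique _ _ (adj⇒∈K wu) (adj⇒∈K wv) u≢v
      ; nonNeighbours-independent = λ ¬wu ¬wv → independent _ _ (¬adj⇒∈S ¬wu) (¬adj⇒∈S ¬wv)
      }
      where
      adj⇒∈K : ∀ {u} → Adj w u → u ∈ K
      adj⇒∈K wu = ∉S⇒∈K (λ u∈S → independent _ _ (∉K⇒∈S w∉K) u∈S wu)
      ¬adj⇒∈S : ∀ {u} → ¬ Adj w u → u ∈ S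
      ¬adj⇒∈S ¬wu = ∉K⇒∈S (λ u∈K → ¬wu (cl _ _ w∈C (K⊆C u∈K) (λ { refl → w∉K u∈K })))

    from-independent : ∀ {I} → IsIndependent G I → ∣ S ∣ ℕ.< ∣ I ∣ → ∃[ w ] IsSwing w
    from-independent {I} ind ∣S∣<∣I∣ with one-excess I S
      (λ u∈I u∉S v∈I v∉S → clique-∩-independent clique ind (∉S⇒∈K u∉S) u∈I (∉S⇒∈K v∉S) v∈I) ∣S∣<∣I∣
    -- Here I = S + w with w in K, so N(w) = K - w and its complement is I.
    ... | S⊆I , w , w∈I , w∉S = w , record
      { neighbours-clique = λ wu wv u≢v → clique _ _ (adj⇒∈K wu) (adj⇒∈K wv) u≢v
      ; nonNeighbours-independent = λ ¬wu ¬wv → ind _ _ (¬adj⇒∈I ¬wu) (¬adj⇒∈I ¬wv)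
      }
      where
      adj⇒∈K : ∀ {u} → Adj w u → u ∈ K
      adj⇒∈K wu = ∉S⇒∈K (λ u∈S → ind _ _ w∈I (S⊆I u∈S) wu)
      ¬adj⇒∈I : ∀ {u} → ¬ Adj w u → u ∈ I
      ¬adj⇒∈I {u} ¬wu = decidable-stable (u ∈? I) λ u∉I →
        ¬wu (clique _ _ (∉S⇒∈K w∉S) (∉S⇒∈K (u∉I ∘ S⊆I)) (λ { refl → u∉I w∈I }))

    by-deficiency : Dec (∣ K ∣ ≡ ω G) → ∃[ w ] IsSwing w
    by-deficiency (no ∣K∣≢ω) with larger (isClique? G) clique ∣K∣≢ω
    ... | _ , cl , ∣K∣<∣C∣ = from-clique cl ∣K∣<∣C∣
    by-deficiency (yes ∣K∣≡ω) with larger (isIndependent? G) independent (λ ∣S∣≡α → unbalanced (∣K∣≡ω , ∣S∣≡α))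
    ... | _ , ind , ∣S∣<∣I∣ = from-independent ind ∣S∣<∣I∣

  module _ {w : Fin n} (swing : IsSwing w) where

    open IsSwing swing

    -- Let S be the complement of N(w). Elements of I outside S - v lie in the clique N(w), so there
    -- is at most one, while ∣ S - v ∣ < ∣ S ∣ ≤ α = ∣ I ∣; hence `one-excess` applies to I and S -
    -- v.
    maximum-independent-set-misses-only-w : ∀ {I v} → IsMaximumIndependentSet G I → ¬ Adj w v → v ∉ I →
      v ≡ w × ∃[ k ] (Adj w k × (∀ j → ¬ Adj w j → Adj k j → j ≡ w))
    maximum-independent-set-misses-only-w {I} {v} (ind , ∣I∣≡α) ¬wv v∉I
      with one-excess I (S - v) unique ∣S-v∣<∣I∣
      where
      nonNeighbour? : Decidable (λ u → ¬ Adj w u)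
      nonNeighbour? u = ¬? (adj? w u)
      S : Subset n
      S = ofPredicate nonNeighbour?
      S-independent : IsIndependent G S
      S-independent _ _ u∈S v∈S =
        nonNeighbours-independent (∈-ofPredicate⁻ nonNeighbour? u∈S) (∈-ofPredicate⁻ nonNeighbour? v∈S)
      ∣S-v∣<∣I∣ : ∣ S - v ∣ ℕ.< ∣ I ∣
      ∣S-v∣<∣I∣ = ℕ.<-≤-trans (x∈p⇒∣p-x∣<∣p∣ (∈-ofPredicate⁺ nonNeighbour? ¬wv))
        (ℕ.≤-trans (size≤maxSize (isIndependent? G) S-independent) (ℕ.≤-reflexive (sym ∣I∣≡α)))
      adj : ∀ {u} → u ∈ I → u ∉ S - v → Adj w u
      adj {u} u∈I u∉S-v = decidable-stable (adj? w u) λ ¬wu →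
        u∉S-v (x∈p∧x≢y⇒x∈p-y (∈-ofPredicate⁺ nonNeighbour? ¬wu) (λ { refl → v∉I u∈I }))
      unique : ∀ {u u′} → u ∈ I → u ∉ S - v → u′ ∈ I → u′ ∉ S - v → u ≡ u′
      unique {u} {u′} u∈I u∉ u′∈I u′∉ = decidable-stable (u ≟ u′) λ u≢u′ →
        ind u u′ u∈I u′∈I (neighbours-clique (adj u∈I u∉) (adj u′∈I u′∉) u≢u′)
    ... | S-v⊆I , k , k∈I , k∉S-v = v≡w , k , wk , only-w
      where
      ¬wu⇒u∈I : ∀ {u} → ¬ Adj w u → u ≢ v → u ∈ I
      ¬wu⇒u∈I ¬wu u≢v = S-v⊆I (x∈p∧x≢y⇒x∈p-y (∈-ofPredicate⁺ (λ u → ¬? (adj? w u)) ¬wu) u≢v)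
      wk : Adj w k
      wk = decidable-stable (adj? w k) λ ¬wk →
        k∉S-v (x∈p∧x≢y⇒x∈p-y (∈-ofPredicate⁺ (λ u → ¬? (adj? w u)) ¬wk) (λ { refl → v∉I k∈I }))
      v≡w : v ≡ w
      -- If v were not w, then w would remain in I together with its neighbour k.
      v≡w = decidable-stable (v ≟ w) λ v≢w →
        ind w k (¬wu⇒u∈I (irrefl refl) (v≢w ∘ sym)) k∈I wk
      only-w : ∀ j → ¬ Adj w j → Adj k j → j ≡ w
      only-w j ¬wj kj = decidable-stable (j ≟ w) λ j≢w →
        ind k j k∈I (¬wu⇒u∈I ¬wj (λ j≡v → j≢w (trans j≡v v≡w))) kj

    -- The hypothesis of `weighted-squares` with k the indicator of N(w). Consistent combinations of
    -- the four decisions hold by computation; the others contradict irreflexivity, the swing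
    -- property, or i = j.
    adjacency-split : ∀ i j → [ adj? i j ] ℚ.+ [ adj? w i ] ℚ.* [ adj? w j ] ≡
      ([ adj? w i ] ℚ.+ [ adj? w j ]) ℚ.* [ adj? i j ] ℚ.+ [ i ≟ j ] ℚ.* [ adj? w j ]
    adjacency-split i j with adj? i j | adj? w i | adj? w j | i ≟ j
    ... | yes ij | _      | _      | yes i≡j = contradiction ij (irrefl i≡j)
    ... | yes _  | yes _  | yes _  | no _    = refl
    ... | yes _  | yes _  | no _   | no _    = refl
    ... | yes _  | no _   | yes _  | no _    = refl
    ... | yes ij | no ¬wi | no ¬wj | no _    = contradiction ij (nonNeighbours-independent ¬wi ¬wj)
    ... | no ¬ij | yes wi | yes wj | no i≢j  = contradiction (neighbours-clique wi wj i≢j) ¬ij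
    ... | no _   | yes _  | yes _  | yes _   = refl
    ... | no _   | yes wi | no ¬wj | yes i≡j = contradiction (subst (Adj w) i≡j wi) ¬wj
    ... | no _   | no ¬wi | yes wj | yes i≡j = contradiction (subst (Adj w) (sym i≡j) wj) ¬wi
    ... | no _   | yes _  | no _   | no _    = refl
    ... | no _   | no _   | yes _  | no _    = refl
    ... | no _   | no _   | no _   | yes _   = refl
    ... | no _   | no _   | no _   | no _    = refl

    module _ {k} (wk : Adj w k) (only-w : ∀ j → ¬ Adj w j → Adj k j → j ≡ w) where

      -- The vertices k and w are adjacent twins: k sees the rest of the clique N(w), and outside
      -- N(w) only w. So their closed neighbourhoods agree, that is, their rows in A + I are equal.
      rows-k-w : ∀ j → [ adj? k j ] ℚ.+ [ k ≟ j ] ≡ [ adj? w j ] ℚ.+ [ w ≟ j ]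
      rows-k-w j with adj? k j | adj? w j | k ≟ j | w ≟ j
      ... | yes kj | _      | yes k≡j | _       = contradiction kj (irrefl k≡j)
      ... | _      | yes wj | _       | yes w≡j = contradiction wj (irrefl w≡j)
      ... | yes _  | yes _  | no _    | no _    = refl
      ... | yes _  | no _   | no _    | yes _   = refl
      ... | yes kj | no ¬wj | no _    | no w≢j  = contradiction (sym (only-w j ¬wj kj)) w≢j
      ... | no ¬kj | yes wj | no k≢j  | no _    = contradiction (neighbours-clique wk wj k≢j) ¬kj
      ... | no _   | yes _  | yes _   | no _    = refl
      ... | no _   | no ¬wj | yes k≡j | _       = contradiction (subst (Adj w) k≡j wk) ¬wj
      ... | no ¬kj | no _   | no _    | yes w≡j = contradiction (subst (Adj k) w≡j (symm wk)) ¬kj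
      ... | no _   | no _   | no _    | no _    = refl

      -- Equal rows k and w of A + I give (Ax)_k + x_k = (Ax)_w + x_w.
      row-difference : ∀ (x : Vector ℚ n) →
        sum (λ j → [ adj? k j ] ℚ.* x j) ℚ.+ x k ℚ.+ ℚ.- sum (λ j → [ adj? w j ] ℚ.* x j) ≡ x w
      row-difference x = begin
        Ax k ℚ.+ x k ℚ.+ ℚ.- Ax w
          ≡⟨ cong (ℚ._+ ℚ.- Ax w) (add-diagonal k) ⟨
        sum (λ j → ([ adj? k j ] ℚ.+ [ k ≟ j ]) ℚ.* x j) ℚ.+ ℚ.- Ax w
          ≡⟨ cong (ℚ._+ ℚ.- Ax w) (sum-cong-≗ (λ j → cong (ℚ._* x j) (rows-k-w j))) ⟩
        sum (λ j → ([ adj? w j ] ℚ.+ [ w ≟ j ]) ℚ.* x j) ℚ.+ ℚ.- Ax w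
          ≡⟨ cong (ℚ._+ ℚ.- Ax w) (add-diagonal w) ⟩
        Ax w ℚ.+ x w ℚ.+ ℚ.- Ax w
          ≡⟨ solve 2 (λ p q → q :+ p :+ :- q := p) refl (x w) (Ax w) ⟩
        x w ∎
        where
        open ≡-Reasoning
        open ℚ.+-*-Solver
        Ax : Vector ℚ n
        Ax i = sum (λ j → [ adj? i j ] ℚ.* x j)
        add-diagonal : ∀ i → sum (λ j → ([ adj? i j ] ℚ.+ [ i ≟ j ]) ℚ.* x j) ≡ Ax i ℚ.+ x i
        add-diagonal i = begin
          sum (λ j → ([ adj? i j ] ℚ.+ [ i ≟ j ]) ℚ.* x j)
            ≡⟨ sum-cong-≗ (λ j → ℚ.*-distribʳ-+ (x j) [ adj? i j ] [ i ≟ j ]) ⟩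
          sum (λ j → [ adj? i j ] ℚ.* x j ℚ.+ [ i ≟ j ] ℚ.* x j)
            ≡⟨ ∑-distrib-+ (λ j → [ adj? i j ] ℚ.* x j) (λ j → [ i ≟ j ] ℚ.* x j) ⟩
          Ax i ℚ.+ sum (λ j → [ i ≟ j ] ℚ.* x j)
            ≡⟨ cong (Ax i ℚ.+_) (sum-δ i x) ⟩
          Ax i ℚ.+ x i ∎

  -- Vectors in the nullspace of the adjacency matrix

  [adj]-sym : ∀ i j → [ adj? i j ] ≡ [ adj? j i ]
  [adj]-sym i j with adj? i j | adj? j i
  ... | yes _  | yes _  = refl
  ... | no _   | no _   = refl
  ... | yes ij | no ¬ji = contradiction (symm ij) ¬ji
  ... | no ¬ij | yes ji = contradiction (symm ji) ¬ij

  seq-adjacencyMatrix : ∀ i j t → seq (adjacencyMatrix G i j) t ≡ [ adj? i j ]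
  seq-adjacencyMatrix i j t = if-float (λ r → seq r t) (does (adj? i j))

  seq-*ᵥ : ∀ (x : Vector ℝ n) i t →
    seq ((adjacencyMatrix G *ᵥ x) i) t ≡ sum (λ j → [ adj? i j ] ℚ.* seq (x j) t)
  seq-*ᵥ x i t = trans (seq-∑ (λ j → adjacencyMatrix G i j * x j) t)
    (sum-cong-≗ (λ j → cong (ℚ._* seq (x j) t) (seq-adjacencyMatrix i j t)))

  module _ {w : Fin n} (swing : IsSwing w) {x : Vector ℝ n} (Ax≈0 : Nullspace (adjacencyMatrix G) x) where

    row : Fin n → ℕ → ℚ
    row i t = sum (λ j → [ adj? i j ] ℚ.* seq (x j) t)

    null-row : ∀ i → IsNull (row i)
    null-row i = null-cong {seq ((adjacencyMatrix G *ᵥ x) i)} {row i}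
      (≈0⇒null ((adjacencyMatrix G *ᵥ x) i) (Ax≈0 i)) (seq-*ᵥ x i)

    -- `weighted-squares` is applied at each index t with k the indicator of N(w). Then `kx` is
    -- `row w t`, so each summand on its left-hand side has a factor `row i t` tending to 0.
    null-weighted-squares : IsNull (λ t → sum (λ i → [ adj? w i ] ℚ.* (seq (x i) t ℚ.* seq (x i) t)))
    null-weighted-squares = null-cong
      {λ t → xAx t ℚ.+ row w t ℚ.* row w t ℚ.+ ℚ.- (q t ℚ.+ q t)}
      (null-+ {λ t → xAx t ℚ.+ row w t ℚ.* row w t} {λ t → ℚ.- (q t ℚ.+ q t)}
        (null-+ {xAx} {λ t → row w t ℚ.* row w t} null-xAx null-square)
        (null-neg {λ t → q t ℚ.+ q t} (null-+ {q} {q} null-q null-q)))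
      (λ t → weighted-squares (λ i j → [ adj? i j ]) (λ i → [ adj? w i ]) (λ i → seq (x i) t)
               [adj]-sym (adjacency-split swing))
      where
      xAx q : ℕ → ℚ
      xAx t = sum (λ i → seq (x i) t ℚ.* row i t)
      q t = sum (λ i → [ adj? w i ] ℚ.* (seq (x i) t ℚ.* row i t))
      null-xAx : IsNull xAx
      null-xAx = null-sum {f = λ i t → seq (x i) t ℚ.* row i t} (λ i → null-* (x i) {row i} (null-row i))
      null-square : IsNull (λ t → row w t ℚ.* row w t)
      -- `null-*` wants a real as first factor, so one copy of `row w` is read as the sequence of
      -- (Ax)_w; likewise, below, the indicator is read as a matrix entry.
      null-square = null-cong {λ t → seq ((adjacencyMatrix G *ᵥ x) w) t ℚ.* row w t} {λ t → row w t ℚ.* row w t}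
        (null-* ((adjacencyMatrix G *ᵥ x) w) {row w} (null-row w))
        (λ t → cong (ℚ._* row w t) {seq ((adjacencyMatrix G *ᵥ x) w) t} {row w t} (seq-*ᵥ x w t))
      null-q : IsNull q
      null-q = null-sum {f = λ i t → [ adj? w i ] ℚ.* (seq (x i) t ℚ.* row i t)} (λ i → null-cong
        {λ t → seq (adjacencyMatrix G w i) t ℚ.* (seq (x i) t ℚ.* row i t)}
        {λ t → [ adj? w i ] ℚ.* (seq (x i) t ℚ.* row i t)}
        (null-* (adjacencyMatrix G w i) {λ t → seq (x i) t ℚ.* row i t} (null-* (x i) {row i} (null-row i)))
        (λ t → cong (ℚ._* (seq (x i) t ℚ.* row i t)) (seq-adjacencyMatrix w i t)))

    -- The square of x_v is one term, with weight 1, of a null sum of non-negative terms.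
    neighbour-null : ∀ {v} → Adj w v → IsNull (seq (x v))
    neighbour-null {v} wv = null-square⁻¹ {seq (x v)} (null-dominated null-weighted-squares square≤)
      where
      open ℚ.≤-Reasoning
      term : ℕ → Vector ℚ n
      term t i = [ adj? w i ] ℚ.* (seq (x i) t ℚ.* seq (x i) t)
      0≤term : ∀ t i → 0ℚ ℚ.≤ term t i
      0≤term t i = 0≤[]* (adj? w i) (0≤p*p (seq (x i) t))
      [wv]≡1 : [ adj? w v ] ≡ 1ℚ
      [wv]≡1 = cong (λ b → if b then 1ℚ else 0ℚ) (dec-true (adj? w v) wv)
      square≤ : ∀ t → ℚ.∣ seq (x v) t ℚ.* seq (x v) t ∣ ℚ.≤ ℚ.∣ sum (term t) ∣
      square≤ t = begin
        ℚ.∣ p ℚ.* p ∣         ≡⟨ ℚ.0≤p⇒∣p∣≡p (0≤p*p p) ⟩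
        p ℚ.* p               ≡⟨ ℚ.*-identityˡ (p ℚ.* p) ⟨
        1ℚ ℚ.* (p ℚ.* p)      ≡⟨ cong (ℚ._* (p ℚ.* p)) [wv]≡1 ⟨
        term t v              ≤⟨ term≤sum (term t) (0≤term t) v ⟩
        sum (term t)          ≡⟨ ℚ.0≤p⇒∣p∣≡p (sum-nonNeg (term t) (0≤term t)) ⟨
        ℚ.∣ sum (term t) ∣    ∎
        where
        p : ℚ
        p = seq (x v) t

    -- `row-difference` writes x_w through two rows, null by hypothesis on x, and x_k, null because
    -- k is in N(w).
    swing-null : ∀ {k} → Adj w k → (∀ j → ¬ Adj w j → Adj k j → j ≡ w) → IsNull (seq (x w))
    swing-null {k} wk only-w = null-cong
      {λ t → row k t ℚ.+ seq (x k) t ℚ.+ ℚ.- row w t} {seq (x w)}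
      (null-+ {λ t → row k t ℚ.+ seq (x k) t} {λ t → ℚ.- row w t}
        (null-+ {row k} {seq (x k)} (null-row k) (neighbour-null wk)) (null-neg {row w} (null-row w)))
      (λ t → row-difference swing wk only-w (λ i → seq (x i) t))

    -- On N(w) the coordinate vanishes whatever I is; off N(w), missing v forces v = w and provides
    -- the twin k needed by `swing-null`.
    missed-by-maximum-independent-set⇒null : ∀ {I v} → IsMaximumIndependentSet G I → v ∉ I → IsNull (seq (x v))
    missed-by-maximum-independent-set⇒null {v = v} maxI v∉I = by-adjacency (adj? w v)
      where
      by-adjacency : Dec (Adj w v) → IsNull (seq (x v))
      by-adjacency (yes wv) = neighbour-null wv
      by-adjacency (no ¬wv) =
        let v≡w , k , wk , only-w = maximum-independent-set-misses-only-w swing maxI ¬wv v∉I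
        in subst (λ u → IsNull (seq (x u))) (sym v≡w) (swing-null wk only-w)

theorem4p9 : (n : ℕ) (Sp : Graph n) → IsSplit Sp → IsUnbalanced Sp → Supp Sp ⊆ ⋂MaximumIndependentSets Sp
theorem4p9 n Sp _ unbalanced {v} (x , Ax≈0 , xv≉0) I maxI =
  -- Membership in I is decidable, so it is enough to refute v ∉ I, which would make x_v equal to 0.
  decidable-stable (v ∈? I) (contradict (swing-vertex Sp unbalanced))
  where
  contradict : ∃[ w ] IsSwing Sp w → ¬ (v ∉ I)
  contradict (w , swing) v∉I =
    xv≉0 (null⇒≈0 (x v) (missed-by-maximum-independent-set⇒null Sp swing {x} Ax≈0 {I} {v} maxI v∉I))
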